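{- For every $f\in\mathcal F$, the judgement $\vdash f\ \&\ (\{w\mid f\downarrow w\},\ \{w\mid f\uparrow w\})$ is derivable in the empty environment.
   Context: Fix a finite alphabet $\Sigma$ of events; $\Sigma^*$ and $\Sigma^\omega$ are the finite and infinite words, $\Sigma^{\le\omega}=\Sigma^*\cup\Sigma^\omega$. For words $w,u$, $w\cdot u=wu$ if $w$ is finite and $w\cdot u=w$ if $w$ is infinite; concatenation of languages is pointwise. Expressions: $e::=o(a)\mid f\mid e_1;e_2\mid e_1?e_2$ with $a\in\Sigma$ and $f$ a procedure name. A program is a finite set $\mathcal F$ of procedure names together with a defining expression $e_f$ for each $f\in\mathcal F$ using only names from $\mathcal F$ (recursion allowed); such a program is fixed and all expressions use only names from $\mathcal F$. Trace semantics: let $\checkmark\notin\Sigma$. The relations $e\Downarrow w$ and $e\Uparrow w$, for $w\in(\Sigma\uplus\{\checkmark\})^*$, are the least relations closed under: $o(a)\Downarrow a$; $o(a)\Uparrow a$; $e\Uparrow\epsilon$ for every $e$; if $e_f\Downarrow w$ then $f\Downarrow w$; if $e_f\Uparrow w$ then $f\Uparrow\checkmark w$; if $e_1\Downarrow w$ and $e_2\Downarrow u$ then $e_1;e_2\Downarrow wu$; if $e_1\Downarrow w$ and $e_2\Uparrow u$ then $e_1;e_2\Uparrow wu$; if $e_1\Uparrow w$ then $e_1;e_2\Uparrow w$; if $e_1\Downarrow w$ or $e_2\Downarrow w$ then $e_1?e_2\Downarrow w$; if $e_1\Uparrow w$ or $e_2\Uparrow w$ then $e_1?e_2\Uparrow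 w$. Let $\theta$ delete all occurrences of $\checkmark$ from a word. Then $e\downarrow w$ iff $w=\theta(w')$ for some $w'\in(\Sigma\uplus\{\checkmark\})^*$ with $e\Downarrow w'$; and $e\uparrow w$ iff $w=\theta(w')$ for some infinite $w'\in(\Sigma\uplus\{\checkmark\})^\omega$ such that $e\Uparrow u$ for every finite prefix $u$ of $w'$. Let $\mathfrak X$ be a set of variables. For $A\subseteq\Sigma^*$, $A^*$ is the Kleene star and $A^\omega$ is the set of all words $w_0\cdot w_1\cdot w_2\cdots$ with all $w_i\in A$. An expression $V(\mathfrak X)$ is a formal expression $\bigcup_{Y\in\mathfrak X}(A_Y\cdot Y)\cup B$ with $A_Y\subseteq\Sigma^*$, $B\subseteq\Sigma^{\le\omega}$; $V(\mathfrak X-X)$ denotes such an expression with $A_X=\emptyset$; the variable $X$ denotes the expression with $A_X=\{\epsilon\}$, other $A_Y=\emptyset$, $B=\emptyset$; a language $B$ denotes the expression with all $A_Y=\emptyset$. Operations: $A\cdot V(\mathfrak X)=\bigcup_Y((A\cdot A_Y)\cdot Y)\cup(A\cdot B)$, $V\cup V'$ componentwise. Two expressions denoting the same formal data are identified. An environment $\Delta$ is a finite set of bindings $f\ \&\ (U,X)$ with $f\in\mathcal F$, $U\subseteq\Sigma^*$, $X\in\mathfrak X$, distinct bindings using distinct variables. Judgements $\Delta\vdash e\ \&\ (U,V(\mathfrak X))$ are derived by: (i) $\Delta\vdash o(a)\ \&\ (\{a\},\emptyset)$; (ii) from $\Delta\vdash e_1\ \&\ (U_1,V_1(\mathfrak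 X))$ and $\Delta\vdash e_2\ \&\ (U_2,V_2(\mathfrak X))$ infer $\Delta\vdash e_1;e_2\ \&\ (U_1\cdot U_2, V_1(\mathfrak X)\cup U_1\cdot V_2(\mathfrak X))$; (iii) from the same premises infer $\Delta\vdash e_1?e_2\ \&\ (U_1\cup U_2, V_1(\mathfrak X)\cup V_2(\mathfrak X))$; (iv) $\Delta,f\ \&\ (U,X)\vdash f\ \&\ (U,X)$; (v) from $\Delta, f\ \&\ (U,X)\vdash e_f\ \&\ (U,A\cdot X\cup V(\mathfrak X-X))$ infer $\Delta\vdash f\ \&\ (U,A^*\cdot V(\mathfrak X-X)\cup A^\omega)$.
   Formalization: The rule for finite traces of a call is corrected to "if e_f ⇓ w then f ⇓ ✓w"; with the rule as given, e_f = (f;o(a))?o(a) has f↑a^ω, which no derivation yields. Also, 𝔛 is assumed to have at least as many variables as there are procedure names (the claim fails for empty 𝔛). -}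

module Defs where

open import Level using (0ℓ) 
open import Data.Nat.Base using (ℕ; zero; suc)
open import Data.List.Base using (List; []; _∷_; [_]; _++_; length; concat; catMaybes; applyUpTo)
open import Data.List.Fresh using (List#; []; cons; _#_)
import Data.List.Fresh.Relation.Unary.Any as Fresh
open import Data.List.Relation.Binary.Prefix.Heterogeneous using (Prefix)
open import Data.List.Relation.Unary.All using (All)
open import Data.Maybe.Base using (Maybe; just; nothing)
open import Data.Product.Base using (∃-syntax; _×_; _,_)
open import Function.Bundles using (_⇔_)
open import Relation.Binary.PropositionalEquality using (_≡_; _≢_; _≗_)
open import Relation.Unary using (Pred; ∅; _∪_; _≐_; ｛_｝)

infix  4 _⊑_ _≈_ _IsLimitOf_ _≋_
infixr 7 _·_ _⊙_ _·ₗ_ _·ₑ_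
infixr 6 _∪ₑ_
infixr 6 _⨾_
infixr 5 _⊕_
infix  8 _⋆ _^ω

-- Finite and infinite words

data Word (A : Set) : Set where
  fin : List A → Word A
  inf : (ℕ → A) → Word A

data _≈_ {A : Set} : Word A → Word A → Set where
  fin : ∀ {u v} → u ≡ v → fin u ≈ fin v
  inf : ∀ {u v} → u ≗ v → inf u ≈ inf v

prepend : {A : Set} → List A → (ℕ → A) → (ℕ → A)
prepend []      v n       = v n
prepend (a ∷ u) v zero    = a
prepend (a ∷ u) v (suc n) = prepend u v n

_·_ : {A : Set} → List A → Word A → Word A
u · fin v = fin (u ++ v)
u · inf v = inf (prepend u v)

_⊑_ : {A : Set} → List A → Word A → Set
u ⊑ fin v = Prefix _≡_ u v
u ⊑ inf v = u ≡ applyUpTo v (length u)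

-- For a sequence c increasing in the prefix order, its limit is the unique
-- (up to _≈_) finite or infinite word whose finite prefixes are exactly the
-- prefixes of the c n.
_IsLimitOf_ : {A : Set} → Word A → (ℕ → List A) → Set
x IsLimitOf c = ∀ u → u ⊑ x ⇔ (∃[ n ] u ⊑ fin (c n))

-- Languages

Lang : Set → Set₁
Lang A = Pred (List A) 0ℓ

Lang∞ : Set → Set₁
Lang∞ A = Pred (Word A) 0ℓ

_⊙_ : {A : Set} → Lang A → Lang A → Lang A
(U ⊙ U′) w = ∃[ u ] ∃[ v ] U u × U′ v × w ≡ u ++ v

_·ₗ_ : {A : Set} → Lang A → Lang∞ A → Lang∞ A
(U ·ₗ B) w = ∃[ u ] ∃[ v ] U u × B v × w ≈ u · v

_⋆ : {A : Set} → Lang A → Lang A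
(U ⋆) w = ∃[ ws ] All U ws × w ≡ concat ws

-- The product may be a finite word, when almost all factors are empty.
_^ω : {A : Set} → Lang A → Lang∞ A
(U ^ω) x = ∃[ ws ] (∀ i → U (ws i)) × x IsLimitOf (λ n → concat (applyUpTo ws n))

-- Programs

data Expr (Event Proc : Set) : Set where
  o    : Event → Expr Event Proc
  call : Proc → Expr Event Proc
  _⨾_  : Expr Event Proc → Expr Event Proc → Expr Event Proc
  _⊕_  : Expr Event Proc → Expr Event Proc → Expr Event Proc   -- e₁ ? e₂

Program : Set → Set → Set
Program Event Proc = Proc → Expr Event Proc

-- Trace semantics; `nothing` is the tick marking a procedure call.

pattern ✓ = nothing

module Semantics {Event Proc : Set} (P : Program Event Proc) where

  infix 4 _⇓_ _⇑_ _↓_ _↑_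

  data _⇓_ : Expr Event Proc → List (Maybe Event) → Set where
    out  : ∀ {a} → o a ⇓ [ just a ]
    -- The tick is needed here as well as in _⇑_.  With the rule
    -- "P f ⇓ w implies call f ⇓ w", the program f = (f ; o(a)) ? o(a) would
    -- have call f ⇑ ✓aⁿ for every n, hence call f ↑ a^ω, although no run of f
    -- outputs a^ω.  The relation _↓_ is the same for both rules.
    call : ∀ {f w} → P f ⇓ w → call f ⇓ ✓ ∷ w
    seq  : ∀ {e₁ e₂ w u} → e₁ ⇓ w → e₂ ⇓ u → e₁ ⨾ e₂ ⇓ w ++ u
    altˡ : ∀ {e₁ e₂ w} → e₁ ⇓ w → e₁ ⊕ e₂ ⇓ w
    altʳ : ∀ {e₁ e₂ w} → e₂ ⇓ w → e₁ ⊕ e₂ ⇓ w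

  data _⇑_ : Expr Event Proc → List (Maybe Event) → Set where
    out  : ∀ {a} → o a ⇑ [ just a ]
    stop : ∀ {e} → e ⇑ []
    call : ∀ {f w} → P f ⇑ w → call f ⇑ ✓ ∷ w
    seqʳ : ∀ {e₁ e₂ w u} → e₁ ⇓ w → e₂ ⇑ u → e₁ ⨾ e₂ ⇑ w ++ u
    seqˡ : ∀ {e₁ e₂ w} → e₁ ⇑ w → e₁ ⨾ e₂ ⇑ w
    altˡ : ∀ {e₁ e₂ w} → e₁ ⇑ w → e₁ ⊕ e₂ ⇑ w
    altʳ : ∀ {e₁ e₂ w} → e₂ ⇑ w → e₁ ⊕ e₂ ⇑ w

  -- Deletion of ticks is `catMaybes` on finite words, extended to infinite
  -- words as the limit over their finite prefixes.

  _↓_ : Expr Event Proc → List Event → Set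
  e ↓ w = ∃[ w′ ] e ⇓ w′ × w ≡ catMaybes w′

  _↑_ : Expr Event Proc → Word Event → Set
  e ↑ w = ∃[ w′ ] (∀ n → e ⇑ applyUpTo w′ n)
                × w IsLimitOf (λ n → catMaybes (applyUpTo w′ n))

-- Formal expressions ⋃_Y (coeff Y · Y) ∪ const

record VExpr (Event Var : Set) : Set₁ where
  constructor mkVExpr
  field
    coeff : Var → Lang Event
    const : Lang∞ Event

open VExpr public

-- Equality of formal data
_≋_ : {Event Var : Set} → VExpr Event Var → VExpr Event Var → Set
V ≋ V′ = (∀ Y → coeff V Y ≐ coeff V′ Y) × const V ≐ const V′

varₑ : {Event Var : Set} → Var → VExpr Event Var
coeff (varₑ X) Y w = X ≡ Y × w ≡ []
const (varₑ X)     = ∅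

langₑ : {Event Var : Set} → Lang∞ Event → VExpr Event Var
coeff (langₑ B) Y = ∅
const (langₑ B)   = B

_·ₑ_ : {Event Var : Set} → Lang Event → VExpr Event Var → VExpr Event Var
coeff (U ·ₑ V) Y = U ⊙ coeff V Y
const (U ·ₑ V)   = U ·ₗ const V

_∪ₑ_ : {Event Var : Set} → VExpr Event Var → VExpr Event Var → VExpr Event Var
coeff (V ∪ₑ V′) Y = coeff V Y ∪ coeff V′ Y
const (V ∪ₑ V′)   = const V ∪ const V′

record Binding (Event Proc Var : Set) : Set₁ where
  constructor _&⟨_,_⟩
  field
    proc : Proc
    lang : Lang Event
    var  : Var

open Binding public

-- Finite collections of bindings with pairwise distinct variables
Env : (Event Proc Var : Set) → Set₁
Env Event Proc Var = List# (Binding Event Proc Var) (λ b b′ → var b ≢ var b′)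

-- The effect system

module Effects {Event Proc : Set} (P : Program Event Proc) (Var : Set) where

  infix 3 _⊢_&_

  data _⊢_&_ (Δ : Env Event Proc Var) :
             Expr Event Proc → Lang Event × VExpr Event Var → Set₁ where

    out : ∀ {a} → Δ ⊢ o a & (｛ [ a ] ｝ , langₑ ∅)

    seq : ∀ {e₁ e₂ U₁ U₂ V₁ V₂} →
          Δ ⊢ e₁ & (U₁ , V₁) → Δ ⊢ e₂ & (U₂ , V₂) →
          Δ ⊢ e₁ ⨾ e₂ & (U₁ ⊙ U₂ , V₁ ∪ₑ U₁ ·ₑ V₂)

    alt : ∀ {e₁ e₂ U₁ U₂ V₁ V₂} →
          Δ ⊢ e₁ & (U₁ , V₁) → Δ ⊢ e₂ & (U₂ , V₂) →
          Δ ⊢ e₁ ⊕ e₂ & (U₁ ∪ U₂ , V₁ ∪ₑ V₂)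

    hyp : ∀ {f U X} → Fresh.Any (f &⟨ U , X ⟩ ≡_) Δ →
          Δ ⊢ call f & (U , varₑ X)

    rec : ∀ {f U X A V} (fresh : f &⟨ U , X ⟩ # Δ) → coeff V X ≐ ∅ →
          cons (f &⟨ U , X ⟩) Δ fresh ⊢ P f & (U , A ·ₑ varₑ X ∪ₑ V) →
          Δ ⊢ call f & (U , A ⋆ ·ₑ V ∪ₑ langₑ (A ^ω))

    -- Languages are sets and expressions with equal data are identified.
    conv : ∀ {e U U′ V V′} → U ≐ U′ → V ≋ V′ →
           Δ ⊢ e & (U , V) → Δ ⊢ e & (U′ , V′)

-- Idea: with ticks kept, the infinite traces of an expression are described by a
-- formal expression in which a variable g stands for the infinite traces of the
-- procedure g.  König's lemma (a pigeonhole over split points) handles e₁ ; e₂.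
-- At a recursive call every word of the coefficient of the procedure itself
-- starts with a tick, so it is nonempty and Arden's rule solves the equation
-- X = A·X ∪ E by A*·E ∪ A^ω, with all factors of A^ω contributing.  Deleting the
-- ticks is a homomorphism for ∪, ·, * and, because the ticked factors are
-- nonempty, for ω-powers; hence it turns the ticked solution into the effect.
-- Recursing into a procedure binds it, so the derivation terminates once all of
-- the finitely many procedures are bound.

module Submission where

open import Defs
open import Level using (0ℓ)
open import Axiom.ExcludedMiddle using (ExcludedMiddle)
open import Data.Nat.Base using (ℕ; zero; suc; _+_; _≤_; _<_; z≤n; s≤s; _⊔_)
open import Data.Nat.Properties
open import Data.Empty using (⊥)
open import Data.Fin.Base using (Fin; punchIn; punchOut)
open import Data.Fin.Properties using (punchIn-punchOut) renaming (_≟_ to _≟ᶠ_)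
open import Data.List.Base using (List; []; _∷_; [_]; _++_; length; concat; catMaybes; applyUpTo)
open import Data.List.Properties using (++-assoc; ++-identityʳ; length-++; length-applyUpTo; ∷-injective; catMaybes-++)
open import Data.List.Fresh using (List#; []; cons; _#_; map)
open import Data.List.Fresh.Relation.Unary.Any using (Any; here; there; any?)
open import Data.List.Fresh.Relation.Unary.All.Properties using (fromAll)
open import Data.List.Fresh.Relation.Unary.Any.Properties using (¬Any⇒All)
open import Data.List.NonEmpty.Base using (List⁺; _∷_; toList)
open import Data.List.Relation.Binary.Prefix.Heterogeneous as Prefix using (Prefix; []; _∷_)
import Data.List.Relation.Binary.Prefix.Heterogeneous.Properties as Prefix
import Data.List.Relation.Binary.Pointwise as Pointwise
open import Data.List.Relation.Unary.All using (All; []; _∷_)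
open import Data.List.Relation.Unary.All.Properties using (applyUpTo⁺₂)
open import Data.Maybe.Base using (Maybe)
open import Data.Product.Base using (Σ; ∃-syntax; _×_; _,_; proj₁; proj₂)
open import Data.Sum.Base using (_⊎_; inj₁; inj₂)
open import Function.Base using (_∘_)
open import Function.Bundles using (_↔_; _↣_; Inverse; Injection; Equivalence; mk⇔)
open import Relation.Binary.PropositionalEquality using (_≡_; _≢_; _≗_; refl; sym; trans; cong; cong₂; subst)
open import Relation.Nullary using (¬_; Dec; yes; no; contradiction)
open import Relation.Unary using (Pred; ∅; _∪_; _≐_; ｛_｝)

private
  variable
    A Event Proc Var : Set

infix 4 _≼_ _◃_ _≍_

-- Prefixes and limits

_≼_ : List A → List A → Set
_≼_ = Prefix _≡_

≼-refl : {u : List A} → u ≼ u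
≼-refl = Prefix.fromPointwise (Pointwise.refl refl)

≼-reflexive : {u v : List A} → u ≡ v → u ≼ v
≼-reflexive refl = ≼-refl

≼-trans : {u v w : List A} → u ≼ v → v ≼ w → u ≼ w
≼-trans = Prefix.trans trans

++-monoʳ-≼ : (u : List A) {v w : List A} → v ≼ w → u ++ v ≼ u ++ w
++-monoʳ-≼ u = Prefix.++⁺ (Pointwise.refl refl)

≼-++⁻ : (u : List A) {v p : List A} → p ≼ u ++ v →
        p ≼ u ⊎ ∃[ q ] p ≡ u ++ q × q ≼ v
≼-++⁻ []      p≼          = inj₂ (_ , refl , p≼)
≼-++⁻ (a ∷ u) []          = inj₁ []
≼-++⁻ (a ∷ u) (refl ∷ p≼) with ≼-++⁻ u p≼
... | inj₁ p≼u              = inj₁ (refl ∷ p≼u)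
... | inj₂ (q , refl , q≼v) = inj₂ (q , refl , q≼v)

≼⇒∃++ : {u w : List A} → u ≼ w → ∃[ v ] w ≡ u ++ v
≼⇒∃++ []          = _ , refl
≼⇒∃++ (refl ∷ u≼) with ≼⇒∃++ u≼
... | v , refl = v , refl

++-cancelˡ-≼ : (u : List A) {v w : List A} → u ++ v ≼ u ++ w → v ≼ w
++-cancelˡ-≼ []      p       = p
++-cancelˡ-≼ (a ∷ u) (_ ∷ p) = ++-cancelˡ-≼ u p

catMaybes-mono-≼ : {u v : List (Maybe A)} → u ≼ v → catMaybes u ≼ catMaybes v
catMaybes-mono-≼ {u = u} u≼v with ≼⇒∃++ u≼v
... | r , refl = subst (catMaybes u ≼_) (sym (catMaybes-++ u r)) (≼-refl Prefix.++ᵖ _)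

applyUpTo-mono-≼ : (x : ℕ → A) {m n : ℕ} → m ≤ n → applyUpTo x m ≼ applyUpTo x n
applyUpTo-mono-≼ x z≤n       = []
applyUpTo-mono-≼ x (s≤s m≤n) = refl ∷ applyUpTo-mono-≼ (x ∘ suc) m≤n

applyUpTo-cong : {x y : ℕ → A} → x ≗ y → applyUpTo x ≗ applyUpTo y
applyUpTo-cong x≗y zero    = refl
applyUpTo-cong x≗y (suc n) = cong₂ _∷_ (x≗y 0) (applyUpTo-cong (x≗y ∘ suc) n)

applyUpTo-prepend : (u : List A) (v : ℕ → A) (n : ℕ) →
                    applyUpTo (prepend u v) (length u + n) ≡ u ++ applyUpTo v n
applyUpTo-prepend []      v n = refl
applyUpTo-prepend (a ∷ u) v n = cong (a ∷_) (applyUpTo-prepend u v n)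

prepend-applyUpTo : (x : ℕ → A) (k : ℕ) → x ≗ prepend (applyUpTo x k) (x ∘ (k +_))
prepend-applyUpTo x zero    n       = refl
prepend-applyUpTo x (suc k) zero    = refl
prepend-applyUpTo x (suc k) (suc n) = prepend-applyUpTo (x ∘ suc) k n

prepend-++ : (u v : List A) (x : ℕ → A) → prepend (u ++ v) x ≗ prepend u (prepend v x)
prepend-++ []      v x n       = refl
prepend-++ (a ∷ u) v x zero    = refl
prepend-++ (a ∷ u) v x (suc n) = prepend-++ u v x n

prepend-cong : (u : List A) {x y : ℕ → A} → x ≗ y → prepend u x ≗ prepend u y
prepend-cong []      x≗y n       = x≗y n
prepend-cong (a ∷ u) x≗y zero    = refl
prepend-cong (a ∷ u) x≗y (suc n) = prepend-cong u x≗y n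

≈-sym : {x y : Word A} → x ≈ y → y ≈ x
≈-sym (fin eq) = fin (sym eq)
≈-sym (inf eq) = inf (sym ∘ eq)

⊑-resp-≈ : {u : List A} {x y : Word A} → x ≈ y → u ⊑ x → u ⊑ y
⊑-resp-≈     (fin refl) u⊑ = u⊑
⊑-resp-≈ {u = u} (inf eq)   u⊑ = trans u⊑ (applyUpTo-cong eq (length u))

applyUpTo-⊑ : (x : ℕ → A) (n : ℕ) → applyUpTo x n ⊑ inf x
applyUpTo-⊑ x n = cong (applyUpTo x) (sym (length-applyUpTo x n))

≼-⊑-trans : {u v : List A} (x : Word A) → u ≼ v → v ⊑ x → u ⊑ x
≼-⊑-trans (fin _) u≼v v⊑x = ≼-trans u≼v v⊑x
≼-⊑-trans (inf x) u≼v v⊑x = go x u≼v v⊑x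
  where
  go : ∀ {u v} x → u ≼ v → v ⊑ inf x → u ⊑ inf x
  go x []          _  = refl
  go x (refl ∷ u≼) eq with ∷-injective eq
  ... | eq₀ , eqₛ = cong₂ _∷_ eq₀ (go (x ∘ suc) u≼ eqₛ)

-- Mutual cofinality. Sequences related by `_≍_` have the same limits, so one chain of prefixes may
-- be exchanged for another without matching their indices.
_◃_ _≍_ : (c d : ℕ → List A) → Set
c ◃ d = ∀ n → ∃[ m ] c n ≼ d m
c ≍ d = c ◃ d × d ◃ c

≍-sym : {c d : ℕ → List A} → c ≍ d → d ≍ c
≍-sym (p , q) = q , p

≗⇒≍ : {c d : ℕ → List A} → c ≗ d → c ≍ d
≗⇒≍ c≗d = (λ n → n , ≼-reflexive (c≗d n)) , (λ n → n , ≼-reflexive (sym (c≗d n)))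

catMaybes-mono-≍ : {c d : ℕ → List (Maybe A)} → c ≍ d → (catMaybes ∘ c) ≍ (catMaybes ∘ d)
catMaybes-mono-≍ (p , q) =
  (λ n → proj₁ (p n) , catMaybes-mono-≼ (proj₂ (p n))) ,
  (λ n → proj₁ (q n) , catMaybes-mono-≼ (proj₂ (q n)))

IsLimitOf-resp-≍ : {x : Word A} {c d : ℕ → List A} → c ≍ d → x IsLimitOf c → x IsLimitOf d
IsLimitOf-resp-≍ {x = x} {c} {d} (c◃d , d◃c) lim u = mk⇔ to′ from′
  where
  to′ : u ⊑ x → ∃[ n ] u ≼ d n
  to′ u⊑x with Equivalence.to (lim u) u⊑x
  ... | n , u≼ = proj₁ (c◃d n) , ≼-trans u≼ (proj₂ (c◃d n))
  from′ : (∃[ n ] u ≼ d n) → u ⊑ x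
  from′ (n , u≼) = Equivalence.from (lim u) (proj₁ (d◃c n) , ≼-trans u≼ (proj₂ (d◃c n)))

IsLimitOf-resp-≈ : {x y : Word A} {c : ℕ → List A} → x ≈ y → x IsLimitOf c → y IsLimitOf c
IsLimitOf-resp-≈ x≈y lim u =
  mk⇔ (Equivalence.to (lim u) ∘ ⊑-resp-≈ (≈-sym x≈y)) (⊑-resp-≈ x≈y ∘ Equivalence.from (lim u))

IsLimitOf-⊑ : {x : Word A} {c : ℕ → List A} → x IsLimitOf c → ∀ n → c n ⊑ x
IsLimitOf-⊑ lim n = Equivalence.from (lim _) (n , ≼-refl)

prefixes-≍-++ : {w : ℕ → A} (u : List A) (v : ℕ → A) → w ≗ prepend u v →
                applyUpTo w ≍ (λ n → u ++ applyUpTo v n)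
prefixes-≍-++ {w = w} u v w≗ =
  (λ n → n , ≼-trans (applyUpTo-mono-≼ w (m≤n+m n (length u))) (≼-reflexive (eq n))) ,
  (λ n → length u + n , ≼-reflexive (sym (eq n)))
  where
  eq : ∀ n → applyUpTo w (length u + n) ≡ u ++ applyUpTo v n
  eq n = trans (applyUpTo-cong w≗ _) (applyUpTo-prepend u v n)

IsLimitOf⇒≍ : {w : ℕ → A} {c : ℕ → List A} → inf w IsLimitOf c → applyUpTo w ≍ c
IsLimitOf⇒≍ {w = w} lim =
  (λ n → Equivalence.to (lim _) (applyUpTo-⊑ w n)) ,
  (λ n → _ , ≼-reflexive (IsLimitOf-⊑ lim n))

-- Prefixes and limits of concatenations

⊑-·⁻ : (u : List A) (y : Word A) {p : List A} → p ⊑ u · y →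
       p ≼ u ⊎ ∃[ q ] p ≡ u ++ q × q ⊑ y
⊑-·⁻ u       (fin v) p⊑ = ≼-++⁻ u p⊑
⊑-·⁻ []      (inf v) p⊑ = inj₂ (_ , refl , p⊑)
⊑-·⁻ (a ∷ u) (inf v) {[]}    _  = inj₁ []
⊑-·⁻ (a ∷ u) (inf v) {b ∷ p} p⊑ with ∷-injective p⊑
... | refl , p⊑′ with ⊑-·⁻ u (inf v) p⊑′
...   | inj₁ p≼u              = inj₁ (refl ∷ p≼u)
...   | inj₂ (q , refl , q⊑v) = inj₂ (q , refl , q⊑v)

⊑-·⁺ : (u : List A) (y : Word A) {q : List A} → q ⊑ y → u ++ q ⊑ u · y
⊑-·⁺ u       (fin v) q⊑ = ++-monoʳ-≼ u q⊑
⊑-·⁺ []      (inf v) q⊑ = q⊑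
⊑-·⁺ (a ∷ u) (inf v) q⊑ = cong (a ∷_) (⊑-·⁺ u (inf v) q⊑)

⊑-·-cancel : (u : List A) (y : Word A) {q : List A} → u ++ q ⊑ u · y → q ⊑ y
⊑-·-cancel u       (fin v) q⊑ = ++-cancelˡ-≼ u q⊑
⊑-·-cancel []      (inf v) q⊑ = q⊑
⊑-·-cancel (a ∷ u) (inf v) q⊑ = ⊑-·-cancel u (inf v) (proj₂ (∷-injective q⊑))

⊑⇒∃· : {u : List A} (x : Word A) → u ⊑ x → ∃[ y ] x ≈ u · y
⊑⇒∃·         (fin w) u≼w with ≼⇒∃++ u≼w
... | v , refl = fin v , fin refl
⊑⇒∃· {u = u} (inf w) u⊑w =
  inf (w ∘ (length u +_)) ,
  inf (subst (λ p → w ≗ prepend p (w ∘ (length u +_))) (sym u⊑w) (prepend-applyUpTo w (length u)))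

IsLimitOf-·⁺ : (u : List A) (y : Word A) {c : ℕ → List A} → y IsLimitOf c →
               (u · y) IsLimitOf (λ n → u ++ c n)
IsLimitOf-·⁺ u y {c} lim p = mk⇔ to′ from′
  where
  to′ : p ⊑ u · y → ∃[ n ] p ≼ u ++ c n
  to′ p⊑ with ⊑-·⁻ u y p⊑
  ... | inj₁ p≼u              = 0 , p≼u Prefix.++ᵖ c 0
  ... | inj₂ (q , refl , q⊑y) with Equivalence.to (lim q) q⊑y
  ...   | n , q≼c = n , ++-monoʳ-≼ u q≼c
  from′ : (∃[ n ] p ≼ u ++ c n) → p ⊑ u · y
  from′ (n , p≼) = ≼-⊑-trans (u · y) p≼ (⊑-·⁺ u y (IsLimitOf-⊑ lim n))

-- Already `u ++ c 0` is a prefix of `x`, so `x` begins with `u`; the remainder is the limit of `c`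
-- because `u` cancels on both sides of every prefix comparison.
IsLimitOf-·⁻ : (u : List A) (x : Word A) {c : ℕ → List A} → x IsLimitOf (λ n → u ++ c n) →
               ∃[ y ] y IsLimitOf c × x ≈ u · y
IsLimitOf-·⁻ u x {c} lim with ⊑⇒∃· x (≼-⊑-trans x (≼-refl Prefix.++ᵖ c 0) (IsLimitOf-⊑ lim 0))
... | y , x≈ = y , lim′ , x≈
  where
  lim″ : (u · y) IsLimitOf (λ n → u ++ c n)
  lim″ = IsLimitOf-resp-≈ x≈ lim
  lim′ : y IsLimitOf c
  lim′ q = mk⇔
    (λ q⊑y → let n , p≼ = Equivalence.to (lim″ (u ++ q)) (⊑-·⁺ u y q⊑y)
             in n , ++-cancelˡ-≼ u p≼)
    (λ (n , q≼) → ⊑-·-cancel u y (Equivalence.from (lim″ (u ++ q)) (n , ++-monoʳ-≼ u q≼)))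

-- Infinite products of nonempty words

NonEmpty : List A → Set
NonEmpty u = ∃[ v ] u ≡ toList v

length-concat : (ws : ℕ → List A) → (∀ i → NonEmpty (ws i)) → ∀ n →
                n ≤ length (concat (applyUpTo ws n))
length-concat ws ne zero    = z≤n
length-concat ws ne (suc n) with ws 0 | ne 0
... | _ | (a ∷ u) , refl = s≤s (≤-trans (length-concat (ws ∘ suc) (ne ∘ suc) n)
        (≤-trans (m≤n+m _ (length u)) (≤-reflexive (sym (length-++ u)))))

-- Each nonempty factor adds at least one letter, so the product of `length u` factors is long
-- enough to contain the prefix `u` of `x`. With empty factors the products could stop growing short
-- of `x`.
concat-IsLimitOf : {x : ℕ → A} (ws : ℕ → List A) → (∀ i → NonEmpty (ws i)) →
                   (∀ n → concat (applyUpTo ws n) ⊑ inf x) →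
                   inf x IsLimitOf (λ n → concat (applyUpTo ws n))
concat-IsLimitOf {x = x} ws ne ⊑x u = mk⇔
  (λ u⊑x → length u , subst (_≼ concat (applyUpTo ws (length u))) (sym u⊑x)
     (≼-trans (applyUpTo-mono-≼ x (length-concat ws ne (length u)))
              (≼-reflexive (sym (⊑x (length u))))))
  (λ (n , u≼) → ≼-⊑-trans (inf x) u≼ (⊑x n))

-- The list argument is a buffer holding the unread letters of the current factor. As the next
-- factor has a head, every step consumes one index and the recursion is structural.
flatten : List A → (ℕ → List⁺ A) → ℕ → A
flatten (a ∷ u) vs zero    = a
flatten (a ∷ u) vs (suc n) = flatten u vs n
flatten []      vs zero    = List⁺.head (vs 0)
flatten []      vs (suc n) = flatten (List⁺.tail (vs 0)) (vs ∘ suc) n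

flatten-⊑ : (u : List A) (vs : ℕ → List⁺ A) (n : ℕ) →
            u ++ concat (applyUpTo (toList ∘ vs) n) ⊑ inf (flatten u vs)
flatten-⊑ (a ∷ u) vs n       = cong (a ∷_) (flatten-⊑ u vs n)
flatten-⊑ []      vs zero    = refl
flatten-⊑ []      vs (suc n) =
  cong (List⁺.head (vs 0) ∷_) (flatten-⊑ (List⁺.tail (vs 0)) (vs ∘ suc) n)

-- Deletion of ticks from languages

θ : Lang (Maybe A) → Lang A
θ U w = ∃[ w′ ] U w′ × w ≡ catMaybes w′

-- Only the infinite words of `B` contribute. The image may still contain finite words, coming from
-- words with finitely many events and infinitely many ticks.
θ∞ : Lang∞ (Maybe A) → Lang∞ A
θ∞ B x = ∃[ w ] B (inf w) × x IsLimitOf (λ n → catMaybes (applyUpTo w n))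

≐-sym : {P Q : Pred A 0ℓ} → P ≐ Q → Q ≐ P
≐-sym (p , q) = q , p

≐-trans : {P Q R : Pred A 0ℓ} → P ≐ Q → Q ≐ R → P ≐ R
≐-trans (p , q) (p′ , q′) = (λ x → p′ (p x)) , (λ x → q (q′ x))

θ-⊙ : (U V : Lang (Maybe A)) → θ (U ⊙ V) ≐ θ U ⊙ θ V
θ-⊙ U V =
  (λ { (_ , (u , v , Uu , Vv , refl) , refl) →
       _ , _ , (u , Uu , refl) , (v , Vv , refl) , catMaybes-++ u v }) ,
  (λ { (_ , _ , (u , Uu , refl) , (v , Vv , refl) , refl) →
       _ , (u , v , Uu , Vv , refl) , sym (catMaybes-++ u v) })

θ-⋆ : (U : Lang (Maybe A)) → θ (U ⋆) ≐ θ U ⋆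
θ-⋆ U = (λ { (_ , (us , Us , refl) , refl) → ⊆ Us }) , λ { (ws , Ws , refl) → ⊇ Ws }
  where
  ⊆ : ∀ {us} → All U us → (θ U ⋆) (catMaybes (concat us))
  ⊆ []                    = [] , [] , refl
  ⊆ (_∷_ {u} {us} Uu Us) with ⊆ Us
  ... | ws , Ws , eq =
    catMaybes u ∷ ws , (u , Uu , refl) ∷ Ws ,
    trans (catMaybes-++ u (concat us)) (cong (catMaybes u ++_) eq)
  ⊇ : ∀ {ws} → All (θ U) ws → θ (U ⋆) (concat ws)
  ⊇ []                      = [] , ([] , [] , refl) , refl
  ⊇ ((u , Uu , refl) ∷ Ws) with ⊇ Ws
  ... | _ , (us , Us , refl) , eq =
    _ , (u ∷ us , Uu ∷ Us , refl) ,
    trans (cong (catMaybes u ++_) eq) (sym (catMaybes-++ u (concat us)))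

-- The prefixes of `u · v` are cofinal with `u` followed by the prefixes of `v`, and deletion
-- distributes over `_++_`; limits can then be taken on either side of `catMaybes u`.
θ∞-·ₗ : (U : Lang (Maybe A)) (B : Lang∞ (Maybe A)) → θ∞ (U ·ₗ B) ≐ θ U ·ₗ θ∞ B
θ∞-·ₗ {A} U B = ⊆ , ⊇
  where
  chain : (u : List (Maybe A)) (v : ℕ → Maybe A) →
          (λ n → catMaybes (u ++ applyUpTo v n)) ≍ (λ n → catMaybes u ++ catMaybes (applyUpTo v n))
  chain u v = ≗⇒≍ (λ n → catMaybes-++ u (applyUpTo v n))

  ⊆ : ∀ {x} → θ∞ (U ·ₗ B) x → (θ U ·ₗ θ∞ B) x
  ⊆ {x} (w , (u , inf v , Uu , Bv , inf w≗) , lim)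
    with IsLimitOf-·⁻ (catMaybes u) x
           (IsLimitOf-resp-≍ (chain u v)
             (IsLimitOf-resp-≍ (catMaybes-mono-≍ (prefixes-≍-++ u v w≗)) lim))
  ... | y , lim′ , x≈ = catMaybes u , y , (u , Uu , refl) , (v , Bv , lim′) , x≈

  ⊇ : ∀ {x} → (θ U ·ₗ θ∞ B) x → θ∞ (U ·ₗ B) x
  ⊇ (_ , y , (u , Uu , refl) , (v , Bv , lim) , x≈) =
    prepend u v , (u , inf v , Uu , Bv , inf (λ _ → refl)) ,
    IsLimitOf-resp-≈ (≈-sym x≈)
      (IsLimitOf-resp-≍ (catMaybes-mono-≍ (≍-sym (prefixes-≍-++ u v (λ _ → refl))))
        (IsLimitOf-resp-≍ (≍-sym (chain u v)) (IsLimitOf-·⁺ (catMaybes u) y lim)))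

catMaybes-concat : {ws : ℕ → List A} {us : ℕ → List (Maybe A)} →
                   (∀ i → ws i ≡ catMaybes (us i)) → ∀ n →
                   concat (applyUpTo ws n) ≡ catMaybes (concat (applyUpTo us n))
catMaybes-concat                eq zero    = refl
catMaybes-concat {us = us} eq (suc n) =
  trans (cong₂ _++_ (eq 0) (catMaybes-concat (eq ∘ suc) n))
        (sym (catMaybes-++ (us 0) _))

-- Nonemptiness matters for the inclusion from right to left: ticked preimages of the factors
-- multiply to an infinite word even if the erased product is finite, so this product is a
-- legitimate witness for `θ∞`.
θ∞-^ω : (U : Lang (Maybe A)) → (∀ {u} → U u → NonEmpty u) → θ∞ (U ^ω) ≐ θ U ^ω
θ∞-^ω {A} U ne = ⊆ , ⊇
  where
  ⊆ : ∀ {x} → θ∞ (U ^ω) x → (θ U ^ω) x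
  ⊆ (w , (us , Us , limw) , lim) =
    catMaybes ∘ us , (λ i → us i , Us i , refl) ,
    IsLimitOf-resp-≍ (≗⇒≍ (sym ∘ catMaybes-concat {us = us} (λ _ → refl)))
      (IsLimitOf-resp-≍ (catMaybes-mono-≍ (IsLimitOf⇒≍ limw)) lim)

  ⊇ : ∀ {x} → (θ U ^ω) x → θ∞ (U ^ω) x
  ⊇ {x} (ws , Ws , lim) = flatten [] vs , (toList ∘ vs , Us , limw) ,
    IsLimitOf-resp-≍ (catMaybes-mono-≍ (≍-sym (IsLimitOf⇒≍ limw)))
      (IsLimitOf-resp-≍ (≗⇒≍ eq) lim)
    where
    vs : ℕ → List⁺ (Maybe A)
    vs i = proj₁ (ne (proj₁ (proj₂ (Ws i))))
    limw : inf (flatten [] vs) IsLimitOf (λ n → concat (applyUpTo (toList ∘ vs) n))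
    limw = concat-IsLimitOf (toList ∘ vs) (λ i → vs i , refl) (flatten-⊑ [] vs)
    vs≡ : ∀ i → proj₁ (Ws i) ≡ toList (vs i)
    vs≡ i = proj₂ (ne (proj₁ (proj₂ (Ws i))))
    Us : ∀ i → U (toList (vs i))
    Us i = subst U (vs≡ i) (proj₁ (proj₂ (Ws i)))
    eq : (λ n → concat (applyUpTo ws n)) ≗ (λ n → catMaybes (concat (applyUpTo (toList ∘ vs) n)))
    eq = catMaybes-concat (λ i → trans (proj₂ (proj₂ (Ws i))) (cong catMaybes (vs≡ i)))

-- Consequences of excluded middle

module _ (em : ExcludedMiddle 0ℓ) where

  all-or-counterexample : (Q : ℕ → Set) → (∀ n → Q n) ⊎ ∃[ n ] ¬ Q n
  all-or-counterexample Q with em {∃[ n ] ¬ Q n}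
  ... | yes ∃¬ = inj₂ ∃¬
  ... | no ¬∃¬ = inj₁ λ n → decide n
    where
    decide : ∀ n → Q n
    decide n with em {Q n}
    ... | yes q = q
    ... | no ¬q = contradiction (n , ¬q) ¬∃¬

  -- One half of Arden's rule, for the greatest solution of X = U·X ∪ E.
  arden : (U : Lang A) → (∀ {u} → U u → NonEmpty u) → (X E : Pred (ℕ → A) 0ℓ) →
          (∀ {w} → X w → E w ⊎ ∃[ u ] ∃[ r ] U u × X r × w ≗ prepend u r) →
          ∀ {w} → X w → (∃[ u ] ∃[ r ] (U ⋆) u × E r × w ≗ prepend u r) ⊎ (U ^ω) (inf w)
  arden {A} U ne X E step {w} Xw with em {∃[ u ] ∃[ r ] (U ⋆) u × E r × w ≗ prepend u r}
  ... | yes exits = inj₁ exits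
  ... | no ¬exits = inj₂
      ( factor start , (λ i → proj₁ (proj₂ (proj₂ (next (iter i start)))))
      , concat-IsLimitOf (factor start) (λ i → ne (proj₁ (proj₂ (proj₂ (next (iter i start))))))
                         (λ n → factors-⊑ n start))
    where
    Exits : Pred (ℕ → A) 0ℓ
    Exits w = ∃[ u ] ∃[ r ] (U ⋆) u × E r × w ≗ prepend u r

    -- A state is a word of `X` from which `E` is never reached. Hence `step` must split off a
    -- factor, and the remainder is again a state: an exit from it would give an exit from the whole
    -- word.
    State : Set
    State = ∃[ w ] X w × ¬ Exits w

    start : State
    start = w , Xw , ¬exits

    next : (s : State) → ∃[ u ] Σ State λ s′ → U u × proj₁ s ≗ prepend u (proj₁ s′)
    next (w , Xw , ¬exits) with step Xw
    ... | inj₁ Ew                   = contradiction ([] , w , ([] , [] , refl) , Ew , λ _ → refl) ¬exits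
    ... | inj₂ (u , r , Uu , Xr , w≗) = u , (r , Xr , ¬exits ∘ exits) , Uu , w≗
      where
      exits : Exits r → Exits w
      exits (_ , r′ , (us , Us , refl) , Er , r≗) =
        u ++ concat us , r′ , (u ∷ us , Uu ∷ Us , refl) , Er ,
        λ n → trans (w≗ n) (trans (prepend-cong u r≗ n) (sym (prepend-++ u (concat us) r′ n)))

    -- Advancing before iterating makes `factor s (suc i)` compute to `factor s′ i` for the
    -- successor `s′` of `s`, which is what the induction in `factors-⊑` needs.
    iter : ℕ → State → State
    iter zero    s = s
    iter (suc n) s = iter n (proj₁ (proj₂ (next s)))

    factor : State → ℕ → List A
    factor s i = proj₁ (next (iter i s))

    factors-⊑ : ∀ n s → concat (applyUpTo (factor s) n) ⊑ inf (proj₁ s)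
    factors-⊑ zero    s = refl
    factors-⊑ (suc n) s with next s in eq
    ... | u , s′ , _ , w≗ =
      ⊑-resp-≈ (≈-sym (inf w≗)) (⊑-·⁺ u (inf (proj₁ s′)) (factors-⊑ n s′))

-- By monotonicity, the maximum of finitely many bounds works for all of them. Applied to the
-- lengths at which split points fail, this is the pigeonhole step for sequencing.
uniform-bound : (Q : ℕ → ℕ → Set) → (∀ {k m n} → m ≤ n → Q k m → Q k n) →
                (∀ k → ∃[ m ] Q k m) → ∀ n → ∃[ m ] (∀ {k} → k < n → Q k m)
uniform-bound Q mono bound zero    = 0 , λ ()
uniform-bound Q mono bound (suc n) with uniform-bound Q mono bound n | bound n
... | m , below | m′ , at = m ⊔ m′ , λ k<1+n → split (m≤n⇒m<n∨m≡n (≤-pred k<1+n))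
  where
  split : ∀ {k} → k < n ⊎ k ≡ n → Q k (m ⊔ m′)
  split (inj₁ k<n)  = mono (m≤m⊔n m m′) (below k<n)
  split (inj₂ refl) = mono (m≤n⊔m m m′) at

-- Infinite traces

module Traces (em : ExcludedMiddle 0ℓ) {Event Proc : Set} (P : Program Event Proc) where

  open Semantics P

  infix 4 _⇑ω_

  _⇑ω_ : Expr Event Proc → (ℕ → Maybe Event) → Set
  e ⇑ω w = ∀ n → e ⇑ applyUpTo w n

  ⇓-prefix : ∀ {e u w} → u ≼ w → e ⇓ w → e ⇑ u
  ⇓-prefix p           (altˡ d) = altˡ (⇓-prefix p d)
  ⇓-prefix p           (altʳ d) = altʳ (⇓-prefix p d)
  ⇓-prefix []          out      = stop
  ⇓-prefix (refl ∷ []) out      = out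
  ⇓-prefix []          (call d) = stop
  ⇓-prefix (refl ∷ p)  (call d) = call (⇓-prefix p d)
  ⇓-prefix p           (seq {w = w} d d′) with ≼-++⁻ w p
  ... | inj₁ p≼w             = seqˡ (⇓-prefix p≼w d)
  ... | inj₂ (q , refl , q≼) = seqʳ d (⇓-prefix q≼ d′)

  -- In the `seqʳ` case the shorter word may end inside the first component, which had terminated;
  -- there `⇓-prefix` supplies the partial trace.
  ⇑-prefix-closed : ∀ {e u w} → u ≼ w → e ⇑ w → e ⇑ u
  ⇑-prefix-closed p           (seqˡ d) = seqˡ (⇑-prefix-closed p d)
  ⇑-prefix-closed p           (altˡ d) = altˡ (⇑-prefix-closed p d)
  ⇑-prefix-closed p           (altʳ d) = altʳ (⇑-prefix-closed p d)
  ⇑-prefix-closed []          stop     = stop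
  ⇑-prefix-closed []          out      = stop
  ⇑-prefix-closed (refl ∷ []) out      = out
  ⇑-prefix-closed []          (call d) = stop
  ⇑-prefix-closed (refl ∷ p)  (call d) = call (⇑-prefix-closed p d)
  ⇑-prefix-closed p           (seqʳ {w = w} d d′) with ≼-++⁻ w p
  ... | inj₁ p≼w             = seqˡ (⇓-prefix p≼w d)
  ... | inj₂ (q , refl , q≼) = seqʳ d (⇑-prefix-closed q≼ d′)

  ⇑ω-prepend : ∀ {e w} u v → w ≗ prepend u v → (∀ n → e ⇑ u ++ applyUpTo v n) → e ⇑ω w
  ⇑ω-prepend u v w≗ d n with proj₁ (prefixes-≍-++ u v w≗) n
  ... | m , p = ⇑-prefix-closed p (d m)

  -- Inversion of partial and infinite traces

  ⇑-call⁻ : ∀ {f a w} → call f ⇑ a ∷ w → a ≡ ✓ × P f ⇑ w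
  ⇑-call⁻ (call d) = refl , d

  ⇑-⊕⁻ : ∀ {e₁ e₂ w} → e₁ ⊕ e₂ ⇑ w → e₁ ⇑ w ⊎ e₂ ⇑ w
  ⇑-⊕⁻ stop     = inj₁ stop
  ⇑-⊕⁻ (altˡ d) = inj₁ d
  ⇑-⊕⁻ (altʳ d) = inj₂ d

  ⇑-⨾⁻ : ∀ {e₁ e₂ w} → e₁ ⨾ e₂ ⇑ w →
         e₁ ⇑ w ⊎ ∃[ u ] ∃[ v ] e₁ ⇓ u × e₂ ⇑ v × w ≡ u ++ v
  ⇑-⨾⁻ stop       = inj₁ stop
  ⇑-⨾⁻ (seqˡ d)   = inj₁ d
  ⇑-⨾⁻ (seqʳ d d′) = inj₂ (_ , _ , d , d′ , refl)

  ¬o⇑ω : ∀ {a w} → ¬ (o a ⇑ω w)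
  -- A partial trace of `o a` has at most one letter, so length two is already impossible.
  ¬o⇑ω d with d 2
  ... | ()

  ⇑ω-call⁻ : ∀ {f w} → call f ⇑ω w → w ≗ prepend [ ✓ ] (w ∘ suc) × P f ⇑ω (w ∘ suc)
  ⇑ω-call⁻ d = (λ { zero → proj₁ (⇑-call⁻ (d 1)) ; (suc n) → refl }) ,
               (λ n → proj₂ (⇑-call⁻ (d (suc n))))

  -- If `e₁` fails at length `N`, prefix closure makes it fail at all greater lengths. There `e₂`
  -- must succeed, and prefix closure brings its traces down to every length.
  ⇑ω-⊕⁻ : ∀ {e₁ e₂ w} → e₁ ⊕ e₂ ⇑ω w → e₁ ⇑ω w ⊎ e₂ ⇑ω w
  ⇑ω-⊕⁻ {e₁} {e₂} {w} d with all-or-counterexample em (λ n → e₁ ⇑ applyUpTo w n)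
  ... | inj₁ d₁        = inj₁ d₁
  ... | inj₂ (N , ¬d₁) = inj₂ d₂
    where
    d₂ : e₂ ⇑ω w
    d₂ n with ⇑-⊕⁻ (d (N + n))
    ... | inj₁ d₁ = contradiction (⇑-prefix-closed (applyUpTo-mono-≼ w (m≤m+n N n)) d₁) ¬d₁
    ... | inj₂ d₂ = ⇑-prefix-closed (applyUpTo-mono-≼ w (m≤n+m n N)) d₂

  -- If e₁ fails on the prefix of length N, every sufficiently long prefix splits
  -- at a position below N, and some split position must work for all lengths.
  ⇑ω-⨾⁻ : ∀ {e₁ e₂ w} → e₁ ⨾ e₂ ⇑ω w →
          e₁ ⇑ω w ⊎ ∃[ u ] ∃[ v ] e₁ ⇓ u × e₂ ⇑ω v × w ≗ prepend u v
  ⇑ω-⨾⁻ {e₁} {e₂} {w} d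
    with all-or-counterexample em (λ n → e₁ ⇑ applyUpTo w n)
       | em {∃[ k ] (∀ n → e₁ ⇓ applyUpTo w k × e₂ ⇑ applyUpTo (w ∘ (k +_)) n)}
  ... | inj₁ d₁ | _ = inj₁ d₁
  ... | inj₂ _  | yes (k , s) =
    inj₂ (applyUpTo w k , w ∘ (k +_) , proj₁ (s 0) , proj₂ ∘ s , prepend-applyUpTo w k)
  -- The length `N + M` defeats every case: `N` rules out `e₁` alone, and `M` rules out every split
  -- position below `N`.
  ... | inj₂ (N , ¬d₁) | no ¬split = contradiction (⇑-⨾⁻ (d (N + M))) impossible
    where
    Split : ℕ → ℕ → Set
    Split k n = e₁ ⇓ applyUpTo w k × e₂ ⇑ applyUpTo (w ∘ (k +_)) n

    failure : ∀ k → ∃[ n ] ¬ Split k n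
    failure k with all-or-counterexample em (Split k)
    ... | inj₁ s = contradiction (k , s) ¬split
    ... | inj₂ f = f

    bound : ∃[ m ] (∀ {k} → k < N → ¬ Split k m)
    bound = uniform-bound (λ k n → ¬ Split k n)
      (λ m≤n ¬s (s₁ , s₂) → ¬s (s₁ , ⇑-prefix-closed (applyUpTo-mono-≼ _ m≤n) s₂))
      failure N

    M : ℕ
    M = proj₁ bound

    impossible : ¬ (e₁ ⇑ applyUpTo w (N + M) ⊎
                    ∃[ u ] ∃[ v ] e₁ ⇓ u × e₂ ⇑ v × applyUpTo w (N + M) ≡ u ++ v)
    impossible (inj₁ d₁) = ¬d₁ (⇑-prefix-closed (applyUpTo-mono-≼ w (m≤m+n N M)) d₁)
    impossible (inj₂ (u , v , d₁ , d₂ , eq)) = case (length u <? N)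
      where
      u++v⊑w : u ++ v ⊑ inf w
      u++v⊑w = subst (_⊑ inf w) eq (applyUpTo-⊑ w (N + M))
      u⊑w : u ⊑ inf w
      u⊑w = ≼-⊑-trans (inf w) (≼-refl Prefix.++ᵖ v) u++v⊑w
      w≗ : w ≗ prepend u (w ∘ (length u +_))
      w≗ = subst (λ p → w ≗ prepend p (w ∘ (length u +_))) (sym u⊑w) (prepend-applyUpTo w (length u))
      v⊑ : v ⊑ inf (w ∘ (length u +_))
      v⊑ = ⊑-·-cancel u (inf (w ∘ (length u +_))) (⊑-resp-≈ (inf w≗) u++v⊑w)
      lengths : N + M ≡ length u + length v
      lengths = trans (sym (length-applyUpTo w (N + M))) (trans (cong length eq) (length-++ u))
      -- A split below `N` leaves at least `M` letters to `e₂`, against the bound. A split at or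
      -- beyond `N` makes the prefix of length `N` a partial trace of `e₁`.
      case : Dec (length u < N) → ⊥
      case (yes u<N) = proj₂ bound u<N
        ( subst (e₁ ⇓_) u⊑w d₁
        , ⇑-prefix-closed (applyUpTo-mono-≼ _ M≤v) (subst (e₂ ⇑_) v⊑ d₂))
        where
        M≤v : M ≤ length v
        M≤v = +-cancelˡ-≤ (length u) M (length v)
          (≤-trans (+-monoˡ-≤ M (<⇒≤ u<N)) (≤-reflexive lengths))
      case (no u≮N) = ¬d₁ (⇓-prefix
        (≼-trans (applyUpTo-mono-≼ w (≮⇒≥ u≮N)) (≼-reflexive (sym u⊑w))) d₁)

  -- Formal expressions over ticked words, with one variable per procedure,
  -- that describe the infinite ticked traces of e in terms of those of the
  -- procedures.
  record Describes (e : Expr Event Proc) (C : VExpr (Maybe Event) Proc) : Set where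
    field
      coeff-sound : ∀ {g u v} → coeff C g u → call g ⇑ v → e ⇑ u ++ v
      const-sound : ∀ {w} → const C (inf w) → e ⇑ω w
      complete    : ∀ {w} → e ⇑ω w → const C (inf w) ⊎
                    ∃[ g ] ∃[ u ] ∃[ v ] coeff C g u × call g ⇑ω v × w ≗ prepend u v

  open Describes

  -- Descriptions of the expression forms

  o-describes : ∀ {a} → Describes (o a) (langₑ ∅)
  o-describes .coeff-sound ()
  o-describes .const-sound ()
  o-describes .complete d = contradiction d ¬o⇑ω

  var-describes : ∀ {f} → Describes (call f) (varₑ f)
  var-describes .coeff-sound (refl , refl) d = d
  var-describes .const-sound ()
  var-describes {f} .complete {w} d = inj₂ (f , [] , w , (refl , refl) , d , λ _ → refl)

  ⨾-describes : ∀ {e₁ e₂ C₁ C₂} → Describes e₁ C₁ → Describes e₂ C₂ →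
                Describes (e₁ ⨾ e₂) (C₁ ∪ₑ (e₁ ⇓_) ·ₑ C₂)
  ⨾-describes D₁ D₂ .coeff-sound (inj₁ c) d = seqˡ (coeff-sound D₁ c d)
  ⨾-describes {e₁} {e₂} D₁ D₂ .coeff-sound {v = v} (inj₂ (u₁ , u₂ , d₁ , c , refl)) d =
    subst (e₁ ⨾ e₂ ⇑_) (sym (++-assoc u₁ u₂ v)) (seqʳ d₁ (coeff-sound D₂ c d))
  ⨾-describes D₁ D₂ .const-sound (inj₁ c) n = seqˡ (const-sound D₁ c n)
  ⨾-describes D₁ D₂ .const-sound (inj₂ (u , inf v , d₁ , c , inf w≗)) =
    ⇑ω-prepend u v w≗ (λ n → seqʳ d₁ (const-sound D₂ c n))
  ⨾-describes D₁ D₂ .complete d with ⇑ω-⨾⁻ d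
  ... | inj₁ d₁ with complete D₁ d₁
  ...   | inj₁ c                         = inj₁ (inj₁ c)
  ...   | inj₂ (g , u , v , c , d′ , w≗) = inj₂ (g , u , v , inj₁ c , d′ , w≗)
  ⨾-describes D₁ D₂ .complete d | inj₂ (u , v , d₁ , d₂ , w≗) with complete D₂ d₂
  ...   | inj₁ c = inj₁ (inj₂ (u , inf v , d₁ , c , inf w≗))
  ...   | inj₂ (g , u′ , v′ , c , d′ , v≗) =
    inj₂ (g , u ++ u′ , v′ , inj₂ (u , u′ , d₁ , c , refl) , d′ ,
          λ n → trans (w≗ n) (trans (prepend-cong u v≗ n) (sym (prepend-++ u u′ v′ n))))

  ⊕-describes : ∀ {e₁ e₂ C₁ C₂} → Describes e₁ C₁ → Describes e₂ C₂ →
                Describes (e₁ ⊕ e₂) (C₁ ∪ₑ C₂)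
  ⊕-describes D₁ D₂ .coeff-sound (inj₁ c) d = altˡ (coeff-sound D₁ c d)
  ⊕-describes D₁ D₂ .coeff-sound (inj₂ c) d = altʳ (coeff-sound D₂ c d)
  ⊕-describes D₁ D₂ .const-sound (inj₁ c) n = altˡ (const-sound D₁ c n)
  ⊕-describes D₁ D₂ .const-sound (inj₂ c) n = altʳ (const-sound D₂ c n)
  ⊕-describes D₁ D₂ .complete d with ⇑ω-⊕⁻ d
  ... | inj₁ d₁ with complete D₁ d₁
  ...   | inj₁ c                         = inj₁ (inj₁ c)
  ...   | inj₂ (g , u , v , c , d′ , w≗) = inj₂ (g , u , v , inj₁ c , d′ , w≗)
  ⊕-describes D₁ D₂ .complete d | inj₂ d₂ with complete D₂ d₂
  ...   | inj₁ c                         = inj₁ (inj₂ c)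
  ...   | inj₂ (g , u , v , c , d′ , w≗) = inj₂ (g , u , v , inj₂ c , d′ , w≗)

  call-describes : ∀ {f C} → Describes (P f) C → Describes (call f) (｛ [ ✓ ] ｝ ·ₑ C)
  call-describes D .coeff-sound (_ , _ , refl , c , refl) d = call (coeff-sound D c d)
  call-describes D .const-sound (_ , inf v , refl , c , inf w≗) =
    ⇑ω-prepend [ ✓ ] v w≗ (λ n → call (const-sound D c n))
  call-describes D .complete {w} d with ⇑ω-call⁻ d
  ... | w≗ , d′ with complete D d′
  ...   | inj₁ c = inj₁ ([ ✓ ] , inf (w ∘ suc) , refl , c , inf w≗)
  ...   | inj₂ (g , u , v , c , d″ , eq) =
    inj₂ (g , ✓ ∷ u , v , ([ ✓ ] , u , refl , c , refl) , d″ ,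
          λ { zero → w≗ 0 ; (suc n) → eq n })

  without : Proc → VExpr (Maybe Event) Proc → VExpr (Maybe Event) Proc
  coeff (without f C) g u = f ≢ g × coeff C g u
  const (without f C)     = const C

  -- The solution of Arden's equation over ticked words, in the shape of the conclusion of `rec`.
  loop : Proc → VExpr (Maybe Event) Proc → VExpr (Maybe Event) Proc
  loop f C = coeff C f ⋆ ·ₑ without f C ∪ₑ langₑ (coeff C f ^ω)

  module _ {f C} (nonEmpty : ∀ {u} → coeff C f u → NonEmpty u) (D : Describes (call f) C) where

    -- Since `coeff-sound` speaks of finite partial traces, `v = []` is allowed; with `stop` this
    -- makes each finite product of loop words a partial trace, hence the ω-power sound.
    ⋆-sound : ∀ {us v} → All (coeff C f) us → call f ⇑ v → call f ⇑ concat us ++ v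
    ⋆-sound []                        d = d
    ⋆-sound {v = v} (_∷_ {u} {us} c cs) d =
      subst (call f ⇑_) (sym (++-assoc u (concat us) v)) (coeff-sound D c (⋆-sound cs d))

    loop-describes : Describes (call f) (loop f C)
    loop-describes .coeff-sound (inj₂ ())
    loop-describes .coeff-sound {v = v} (inj₁ (_ , u , (us , cs , refl) , (_ , c) , refl)) d =
      subst (call f ⇑_) (sym (++-assoc (concat us) u v)) (⋆-sound cs (coeff-sound D c d))
    loop-describes .const-sound (inj₁ (_ , inf v , (us , cs , refl) , c , inf w≗)) =
      ⇑ω-prepend (concat us) v w≗ (λ n → ⋆-sound cs (const-sound D c n))
    loop-describes .const-sound (inj₂ (us , cs , lim)) n with proj₁ (IsLimitOf⇒≍ lim) n
    ... | m , p = ⇑-prefix-closed p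
      (subst (call f ⇑_) (++-identityʳ _) (⋆-sound (applyUpTo⁺₂ us m cs) stop))
    loop-describes .complete d with arden em (coeff C f) nonEmpty (call f ⇑ω_) Exit step d
      where
      -- The inhomogeneous part of the equation: all continuations except a return to `f` itself.
      Exit : Pred (ℕ → Maybe Event) 0ℓ
      Exit w = const C (inf w) ⊎
               ∃[ g ] ∃[ u ] ∃[ v ] (f ≢ g × coeff C g u) × call g ⇑ω v × w ≗ prepend u v
      step : ∀ {w} → call f ⇑ω w →
             Exit w ⊎ ∃[ u ] ∃[ v ] coeff C f u × call f ⇑ω v × w ≗ prepend u v
      step d with complete D d
      ... | inj₁ c = inj₁ (inj₁ c)
      ... | inj₂ (g , u , v , c , d′ , w≗) with em {f ≡ g}
      ...   | yes refl = inj₂ (u , v , c , d′ , w≗)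
      ...   | no f≢g   = inj₁ (inj₂ (g , u , v , (f≢g , c) , d′ , w≗))
    ... | inj₁ (u , v , us , inj₁ c , w≗) = inj₁ (inj₁ (u , inf v , us , c , inf w≗))
    ... | inj₁ (u , v , us , inj₂ (g , u′ , v′ , c , d′ , v≗) , w≗) =
      inj₂ (g , u ++ u′ , v′ , inj₁ (u , u′ , us , c , refl) , d′ ,
            λ n → trans (w≗ n) (trans (prepend-cong u v≗ n) (sym (prepend-++ u u′ v′ n))))
    ... | inj₂ ω = inj₁ (inj₂ ω)

-- Derivations

module Derivations (em : ExcludedMiddle 0ℓ) {Event Proc Var : Set} (ι : Proc ↣ Var)
                   (P : Program Event Proc) where

  open Semantics P
  open Effects P Var
  open Traces em P
  open Describes
  open Injection ι using (injective) renaming (to to var-of)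

  -- By injectivity at most one `g` contributes to each `Y`; the existential form avoids an inverse
  -- of `var-of`.
  erase : VExpr (Maybe Event) Proc → VExpr Event Var
  coeff (erase C) Y w = ∃[ g ] var-of g ≡ Y × θ (coeff C g) w
  const (erase C)     = θ∞ (const C)

  ≋-trans : {V W Z : VExpr Event Var} → V ≋ W → W ≋ Z → V ≋ Z
  ≋-trans (p , q) (p′ , q′) = (λ Y → ≐-trans (p Y) (p′ Y)) , ≐-trans q q′

  erase-∪ : ∀ C D → erase C ∪ₑ erase D ≋ erase (C ∪ₑ D)
  erase-∪ C D =
    (λ Y → (λ { (inj₁ (g , eq , u , c , w≡)) → g , eq , u , inj₁ c , w≡
              ; (inj₂ (g , eq , u , c , w≡)) → g , eq , u , inj₂ c , w≡ }) ,
           (λ { (g , eq , u , inj₁ c , w≡) → inj₁ (g , eq , u , c , w≡)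
              ; (g , eq , u , inj₂ c , w≡) → inj₂ (g , eq , u , c , w≡) })) ,
    (λ { (inj₁ (w , c , lim)) → w , inj₁ c , lim
       ; (inj₂ (w , c , lim)) → w , inj₂ c , lim }) ,
    (λ { (w , inj₁ c , lim) → inj₁ (w , c , lim)
       ; (w , inj₂ c , lim) → inj₂ (w , c , lim) })

  erase-· : ∀ U C → θ U ·ₑ erase C ≋ erase (U ·ₑ C)
  erase-· U C =
    (λ Y → (λ { (u , v , Uu , (g , eq , c) , w≡) →
                g , eq , proj₂ (θ-⊙ U (coeff C g)) (u , v , Uu , c , w≡) }) ,
           (λ { (g , eq , c) → let u , v , Uu , c′ , w≡ = proj₁ (θ-⊙ U (coeff C g)) c
                               in u , v , Uu , (g , eq , c′) , w≡ })) ,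
    ≐-sym (θ∞-·ₗ U (const C))

  erase-const : ∀ {B} B′ → B ≐ θ∞ B′ → langₑ B ≋ erase (langₑ B′)
  erase-const _ eq = (λ Y → (λ ()) , (λ ())) , eq

  ·ₑ-congˡ : ∀ {U U′} {V : VExpr Event Var} → U ≐ U′ → U ·ₑ V ≋ U′ ·ₑ V
  ·ₑ-congˡ (p , q) =
    (λ Y → (λ { (u , v , Uu , r) → u , v , p Uu , r }) , (λ { (u , v , Uu , r) → u , v , q Uu , r })) ,
    (λ { (u , v , Uu , r) → u , v , p Uu , r }) , (λ { (u , v , Uu , r) → u , v , q Uu , r })

  ∪ₑ-cong : {V V′ W W′ : VExpr Event Var} → V ≋ V′ → W ≋ W′ → V ∪ₑ W ≋ V′ ∪ₑ W′
  ∪ₑ-cong (p , q) (p′ , q′) = (λ Y → ∪-cong (p Y) (p′ Y)) , ∪-cong q q′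
    where
    ∪-cong : ∀ {X : Set} {A A′ B B′ : Pred X 0ℓ} → A ≐ A′ → B ≐ B′ → A ∪ B ≐ A′ ∪ B′
    ∪-cong (p , q) (p′ , q′) =
      (λ { (inj₁ a) → inj₁ (p a) ; (inj₂ b) → inj₂ (p′ b) }) ,
      (λ { (inj₁ a) → inj₁ (q a) ; (inj₂ b) → inj₂ (q′ b) })

  -- The tick of a call disappears under deletion, so the body and the call have the same erased
  -- effect, although only the latter has nonempty loop words.
  erase-tick : ∀ C → erase C ≋ erase (｛ [ ✓ ] ｝ ·ₑ C)
  erase-tick C =
    (λ Y → (λ { (g , eq , u , c , w≡) → g , eq , ✓ ∷ u , ([ ✓ ] , u , refl , c , refl) , w≡ }) ,
           (λ { (g , eq , _ , (_ , u , refl , c , refl) , w≡) → g , eq , u , c , w≡ })) ,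
    (λ { (v , c , lim) → prepend [ ✓ ] v , ([ ✓ ] , inf v , refl , c , inf (λ _ → refl)) ,
         IsLimitOf-resp-≍ (catMaybes-mono-≍ (≍-sym (prefixes-≍-++ [ ✓ ] v (λ _ → refl)))) lim }) ,
    (λ { (w , (_ , inf v , refl , c , inf w≗) , lim) → v , c ,
         IsLimitOf-resp-≍ (catMaybes-mono-≍ (prefixes-≍-++ [ ✓ ] v w≗)) lim })

  -- Brings the effect of a body into the form `A ·ₑ varₑ X ∪ₑ V` demanded by the premise of `rec`.
  erase-split : ∀ f C → erase C ≋ θ (coeff C f) ·ₑ varₑ (var-of f) ∪ₑ erase (without f C)
  erase-split f C =
    (λ Y → ⊆ , ⊇) , (λ c → inj₂ c) , (λ { (inj₁ (_ , _ , _ , () , _)) ; (inj₂ c) → c })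
    where
    ⊆ : ∀ {Y w} → coeff (erase C) Y w →
        coeff (θ (coeff C f) ·ₑ varₑ (var-of f) ∪ₑ erase (without f C)) Y w
    ⊆ (g , eq , u , c , w≡) with em {f ≡ g}
    ... | yes refl = inj₁ (_ , [] , (u , c , w≡) , (eq , refl) , sym (++-identityʳ _))
    ... | no f≢g   = inj₂ (g , eq , u , (f≢g , c) , w≡)
    ⊇ : ∀ {Y w} → coeff (θ (coeff C f) ·ₑ varₑ (var-of f) ∪ₑ erase (without f C)) Y w →
        coeff (erase C) Y w
    ⊇ (inj₁ (_ , _ , (u , c , refl) , (eq , refl) , refl)) = f , eq , u , c , ++-identityʳ _
    ⊇ (inj₂ (g , eq , u , (_ , c) , w≡))                   = g , eq , u , c , w≡

  erase-loop : ∀ f C → (∀ {u} → coeff C f u → NonEmpty u) →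
               θ (coeff C f) ⋆ ·ₑ erase (without f C) ∪ₑ langₑ (θ (coeff C f) ^ω) ≋ erase (loop f C)
  erase-loop f C ne = ≋-trans
    (∪ₑ-cong (≋-trans (·ₑ-congˡ (≐-sym (θ-⋆ (coeff C f)))) (erase-· (coeff C f ⋆) (without f C)))
             (erase-const (coeff C f ^ω) (≐-sym (θ∞-^ω (coeff C f) ne))))
    (erase-∪ (coeff C f ⋆ ·ₑ without f C) (langₑ (coeff C f ^ω)))

  -- Derivations relative to the bound procedures

  Procs : Set
  Procs = List# Proc _≢_

  binding : Proc → Binding Event Proc Var
  binding g = g &⟨ (λ w → call g ↓ w) , var-of g ⟩

  env : Procs → Env Event Proc Var
  env = map binding (λ g≢h → g≢h ∘ injective)

  infix 4 _∈_

  _∈_ : Proc → Procs → Set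
  g ∈ S = Any (g ≡_) S

  binding-∈ : ∀ {g} {S : Procs} → g ∈ S → Any (binding g ≡_) (env S)
  binding-∈ (here refl) = here refl
  binding-∈ (there g∈)  = there (binding-∈ g∈)

  -- The induction invariant: the derived effect is the erasure of a correct ticked description. The
  -- field `bound` ensures that no variable is left once `S` is empty.
  record Effect (S : Procs) (e : Expr Event Proc) : Set₁ where
    constructor effect
    field
      ticked    : VExpr (Maybe Event) Proc
      derived   : env S ⊢ e & ((λ w → e ↓ w) , erase ticked)
      describes : Describes e ticked
      bound     : ∀ {g u} → coeff ticked g u → g ∈ S

  open Effect

  out-effect : ∀ {S a} → Effect S (o a)
  out-effect = effect (langₑ ∅)
    (conv ((λ { refl → _ , out , refl }) , (λ { (_ , out , refl) → refl }))
          (erase-const ∅ ((λ ()) , (λ { (_ , () , _) }))) out)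
    o-describes (λ ())

  ⨾-effect : ∀ {S e₁ e₂} → Effect S e₁ → Effect S e₂ → Effect S (e₁ ⨾ e₂)
  ⨾-effect {e₁ = e₁} {e₂} (effect C₁ t₁ D₁ b₁) (effect C₂ t₂ D₂ b₂) =
    effect (C₁ ∪ₑ (e₁ ⇓_) ·ₑ C₂)
      (conv (≐-trans (≐-sym (θ-⊙ (e₁ ⇓_) (e₂ ⇓_)))
                     ((λ { (_ , (u , v , d₁ , d₂ , refl) , eq) → u ++ v , seq d₁ d₂ , eq }) ,
                      (λ { (_ , seq d₁ d₂ , eq) → _ , (_ , _ , d₁ , d₂ , refl) , eq })))
            (≋-trans (∪ₑ-cong (≋-refl (erase C₁)) (erase-· (e₁ ⇓_) C₂))
                     (erase-∪ C₁ ((e₁ ⇓_) ·ₑ C₂)))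
            (seq t₁ t₂))
      (⨾-describes D₁ D₂)
      (λ { (inj₁ c) → b₁ c ; (inj₂ (_ , _ , _ , c , _)) → b₂ c })
    where
    ≋-refl : (V : VExpr Event Var) → V ≋ V
    ≋-refl V = (λ Y → (λ z → z) , (λ z → z)) , (λ z → z) , (λ z → z)

  ⊕-effect : ∀ {S e₁ e₂} → Effect S e₁ → Effect S e₂ → Effect S (e₁ ⊕ e₂)
  ⊕-effect (effect C₁ t₁ D₁ b₁) (effect C₂ t₂ D₂ b₂) =
    effect (C₁ ∪ₑ C₂)
      (conv ((λ { (inj₁ (u , d , eq)) → u , altˡ d , eq ; (inj₂ (u , d , eq)) → u , altʳ d , eq }) ,
             (λ { (u , altˡ d , eq) → inj₁ (u , d , eq) ; (u , altʳ d , eq) → inj₂ (u , d , eq) }))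
            (erase-∪ C₁ C₂) (alt t₁ t₂))
      (⊕-describes D₁ D₂)
      (λ { (inj₁ c) → b₁ c ; (inj₂ c) → b₂ c })

  hyp-effect : ∀ {S f} → f ∈ S → Effect S (call f)
  hyp-effect {f = f} f∈S = effect (varₑ f)
    (conv ((λ d → d) , (λ d → d))
          ((λ Y → (λ { (eq , refl) → f , eq , [] , (refl , refl) , refl }) ,
                  (λ { (_ , eq , _ , (refl , refl) , refl) → eq , refl })) ,
           (λ ()) , (λ { (_ , () , _) }))
          (hyp (binding-∈ f∈S)))
    var-describes (λ { (refl , refl) → f∈S })

  rec-effect : ∀ {S f} (f#S : f # S) → Effect (cons f S f#S) (P f) → Effect S (call f)
  rec-effect {S} {f} f#S (effect C′ t D b) = effect (loop f C)
    (conv ((λ d → d) , (λ d → d)) (erase-loop f C nonEmpty)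
      -- A procedure sharing the variable of `f` is `f` by injectivity, and `without` has removed
      -- `f`.
      (rec _ ((λ { (g , eq , _ , (f≢g , _) , _) → contradiction (sym (injective eq)) f≢g }) , (λ ()))
        (conv ((λ { (w , d , eq) → ✓ ∷ w , call d , eq }) , (λ { (_ , call d , eq) → _ , d , eq }))
              (≋-trans (erase-tick C′) (erase-split f C)) t)))
    (loop-describes nonEmpty (call-describes D))
    λ { (inj₁ (_ , _ , _ , (f≢g , _ , _ , _ , c , _) , _)) → drop-f f≢g (b c) }
    where
    -- The leading tick makes the iterated words nonempty, as the ω-power requires.
    C : VExpr (Maybe Event) Proc
    C = ｛ [ ✓ ] ｝ ·ₑ C′
    nonEmpty : ∀ {u} → coeff C f u → NonEmpty u
    nonEmpty (_ , v , refl , _ , eq) = ✓ ∷ v , eq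
    drop-f : ∀ {g} → f ≢ g → g ∈ cons f S f#S → g ∈ S
    drop-f f≢g (here eq)  = contradiction (sym eq) f≢g
    drop-f f≢g (there g∈) = g∈

  -- `rest` lists every procedure that may still be unbound. Unfolding a call removes one index from
  -- it, so `n` decreases where the expression does not.
  derive : ∀ n (rest : Fin n → Proc) (S : Procs) → (∀ g → g ∈ S ⊎ ∃[ i ] rest i ≡ g) →
           ∀ e → Effect S e
  derive n rest S cover (o a)     = out-effect
  derive n rest S cover (e₁ ⨾ e₂) = ⨾-effect (derive n rest S cover e₁) (derive n rest S cover e₂)
  derive n rest S cover (e₁ ⊕ e₂) = ⊕-effect (derive n rest S cover e₁) (derive n rest S cover e₂)
  -- A procedure may be both bound and listed in `rest`, so membership in `S` is decided first;
  -- `rec` needs freshness.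
  derive n rest S cover (call f) with any? (λ g → em {f ≡ g}) S | cover f
  ... | yes f∈S | _                 = hyp-effect f∈S
  ... | no _    | inj₁ f∈S          = hyp-effect f∈S
  derive (suc n) rest S cover (call f) | no f∉S | inj₂ (i , refl) =
    rec-effect f#S (derive n (rest ∘ punchIn i) (cons f S f#S) cover′ (P f))
    where
    f#S : f # S
    f#S = fromAll (¬Any⇒All {Q = f ≡_} (λ g → em {f ≡ g}) f∉S)
    cover′ : ∀ g → g ∈ cons f S f#S ⊎ ∃[ j ] rest (punchIn i j) ≡ g
    cover′ g with cover g
    ... | inj₁ g∈S = inj₁ (there g∈S)
    -- The index `i` is dropped because its procedure is now bound; any other index survives as its
    -- `punchOut`.
    ... | inj₂ (j , refl) with i ≟ᶠ j
    ...   | yes refl = inj₁ (here refl)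
    ...   | no i≢j   = inj₂ (punchOut i≢j , cong rest (punchIn-punchOut i≢j))

  -- With nothing bound all coefficients are empty, so soundness and completeness of the description
  -- identify its constant part with the infinite ticked traces.
  erase-closed : ∀ {e} (E : Effect [] e) → erase (ticked E) ≋ langₑ (λ w → e ↑ w)
  erase-closed {e} (effect C t D b) =
    (λ Y → (λ { (_ , _ , _ , c , _) → contradiction (b c) λ () }) , (λ ())) ,
    (λ { (w , c , lim) → w , const-sound D c , lim }) ,
    (λ { (w , d , lim) → w , closed (complete D d) , lim })
    where
    closed : ∀ {w} → const C (inf w) ⊎
             (∃[ g ] ∃[ u ] ∃[ v ] coeff C g u × call g ⇑ω v × w ≗ prepend u v) → const C (inf w)
    closed (inj₁ c)                   = c
    closed (inj₂ (_ , _ , _ , c , _)) = contradiction (b c) λ ()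

theorem5 : ExcludedMiddle 0ℓ →
    (Event Proc Var : Set) (m k : ℕ) → Event ↔ Fin m → Proc ↔ Fin k → Proc ↣ Var →
    (P : Program Event Proc) →
    let open Semantics P
        open Effects P Var
    in (f : Proc) → [] ⊢ call f & ((λ w → call f ↓ w) , langₑ (λ w → call f ↑ w))
theorem5 em Event Proc Var m k _ enum ι P f =
  Effects.conv ((λ d → d) , (λ d → d)) (erase-closed E) (Effect.derived E)
  where
  open Derivations em ι P
  open Inverse enum using (to; from; strictlyInverseʳ)
  E : Effect [] (call f)
  -- Initially no procedure is bound and the enumeration lists all `k` of them.
  E = derive k from [] (λ g → inj₂ (to g , strictlyInverseʳ g)) (call f)
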